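{- Let $G$ be a finite simple connected graph of order $n$. Then any vertex cover of $G$ is a distance-edge-monitoring set of $G$, and thus $\mathrm{dem}(G)\leq \mathrm{vc}(G)\leq n-1$. Moreover, $\mathrm{dem}(G)=n-1$ if and only if $G$ is the complete graph of order $n$.
   Context: $d_G(x,y)$ denotes the distance between vertices $x,y$ in $G$ (equal to $\infty$ if $x$ and $y$ are in different components), and $G-e$ is the graph obtained from $G$ by deleting the edge $e$. An edge $e$ of $G$ is monitored by a vertex $x$ if there is a vertex $y$ of $G$ with $d_G(x,y)\neq d_{G-e}(x,y)$ (equivalently, $e$ belongs to all shortest paths between $x$ and $y$ in $G$). A set $M\subseteq V(G)$ is distance-edge-monitoring if every edge of $G$ is monitored by some vertex of $M$, and $\mathrm{dem}(G)$ is the smallest size of a distance-edge-monitoring set of $G$. A set $C$ of vertices is a vertex cover of $G$ if every edge of $G$ has at least one endpoint in $C$; $\mathrm{vc}(G)$ is the smallest size of a vertex cover of $G$. -}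

module Defs where

open import Data.Fin.Base using (Fin; zero; suc; toℕ)
open import Data.Fin.Properties using (_≟_; any?; all?; pigeonhole; toℕ≤pred[n])
open import Data.Fin.Subset using (Subset; _∈_; ∣_∣)
open import Data.Fin.Subset.Properties using (_∈?_; anySubset?; ∣p∣≤n)
import Data.Maybe.Properties as Maybe
open import Data.Nat.Base using (ℕ; zero; suc; _+_; _∸_; _≤_; _<_; s≤s)
open import Data.Nat.Induction using (<-rec)
import Data.Nat.Properties as ℕ
open import Data.Product.Base using (∃; ∃-syntax; _×_; _,_; proj₁)
open import Data.Sum.Base using (_⊎_; inj₁; inj₂)
open import Function.Base using (_∘_)
open import Relation.Binary.Construct.Add.Supremum.NonStrict _≤_ using (_≤⁺_) public
open import Relation.Binary.Definitions using (Irreflexive; Symmetric)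
  renaming (Decidable to Decidable₂)
open import Relation.Binary.PropositionalEquality
  using (_≡_; _≢_; refl; sym; subst)
open import Relation.Nullary.Construct.Add.Supremum using (_⁺; ⊤⁺; [_]) public
open import Relation.Nullary.Decidable
  using (Dec; yes; no; map′; ¬?; _×-dec_; _⊎-dec_; _→-dec_)
open import Relation.Nullary.Negation.Core using (¬_; contradiction)
open import Relation.Unary using (Pred; Decidable)

private
  variable
    n k l : ℕ

------------------------------------------------------------------------
-- Minima of sets of naturals, with min ∅ = ∞ (written ⊤⁺)

ℕ∞ : Set
ℕ∞ = ℕ ⁺

IsMin : (ℕ → Set) → ℕ∞ → Set
IsMin P [ k ] = P k × (∀ j → P j → k ≤ j)
IsMin P ⊤⁺    = ∀ j → ¬ P j

module _ {P : ℕ → Set} (P? : Decidable P) where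

  private
    search : ∀ b → (∃[ k ] IsMin P [ k ]) ⊎ (∀ j → j < b → ¬ P j)
    search zero = inj₂ λ _ ()
    search (suc b) with search b
    ... | inj₁ found = inj₁ found
    ... | inj₂ none with P? b
    ...   | yes pb = inj₁ (b , pb , λ j pj → ℕ.≮⇒≥ λ j<b → none j j<b pj)
    ...   | no ¬pb = inj₂ none′
      where
      none′ : ∀ j → j < suc b → ¬ P j
      none′ j (s≤s j≤b) pj with ℕ.m≤n⇒m<n∨m≡n j≤b
      ... | inj₁ j<b  = none j j<b pj
      ... | inj₂ refl = ¬pb pj

  -- The bound b is only there to make the search terminate.
  minimum : ∀ b → (∀ k → P k → ∃[ j ] j < b × P j) → ∃ (IsMin P)
  minimum b bounded with search b
  ... | inj₁ (k , least) = [ k ] , least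
  ... | inj₂ none = ⊤⁺ , λ k pk →
    let (j , j<b , pj) = bounded k pk in none j j<b pj

------------------------------------------------------------------------
-- Finite simple graphs

record Graph (n : ℕ) : Set₁ where
  field
    Adj        : Fin n → Fin n → Set
    adj?       : Decidable₂ Adj
    adj-sym    : Symmetric Adj
    adj-irrefl : Irreflexive _≡_ Adj

open Graph public

Complete : Graph n → Set
Complete G = ∀ x y → x ≢ y → Adj G x y

SameEdge : Fin n → Fin n → Fin n → Fin n → Set
SameEdge x y u v = (x ≡ u × y ≡ v) ⊎ (x ≡ v × y ≡ u)

sameEdge? : (x y u v : Fin n) → Dec (SameEdge x y u v)
sameEdge? x y u v = (x ≟ u ×-dec y ≟ v) ⊎-dec (x ≟ v ×-dec y ≟ u)

deleteEdge : Graph n → Fin n → Fin n → Graph n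
deleteEdge G u v = record
  { Adj        = λ x y → Adj G x y × ¬ SameEdge x y u v
  ; adj?       = λ x y → adj? G x y ×-dec ¬? (sameEdge? x y u v)
  ; adj-sym    = λ (a , ¬s) → adj-sym G a , ¬s ∘ flipEnds
  ; adj-irrefl = λ x≡y (a , _) → adj-irrefl G x≡y a
  }
  where
  flipEnds : ∀ {x y} → SameEdge y x u v → SameEdge x y u v
  flipEnds (inj₁ (p , q)) = inj₂ (q , p)
  flipEnds (inj₂ (p , q)) = inj₁ (q , p)

------------------------------------------------------------------------
-- Walks and distance

infixr 5 _∷_

data Walk (G : Graph n) : ℕ → Fin n → Fin n → Set where
  []  : ∀ {x} → Walk G 0 x x
  _∷_ : ∀ {x y z} → Adj G x y → Walk G k y z → Walk G (suc k) x z

Connected : Graph n → Set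
Connected G = ∀ x y → ∃[ k ] Walk G k x y

module _ (G : Graph n) where

  walk? : ∀ x y → Decidable λ k → Walk G k x y
  walk? x y zero    = map′ (λ { refl → [] }) (λ { [] → refl }) (x ≟ y)
  walk? x y (suc k) = map′ (λ (_ , a , w) → a ∷ w) (λ { (a ∷ w) → _ , a , w })
    (any? λ z → adj? G x z ×-dec walk? z y k)

  private
    vertex : ∀ {x y} → Walk G k x y → Fin (suc k) → Fin n
    vertex {x = x} _       zero    = x
    vertex         (_ ∷ w) (suc i) = vertex w i

    take : ∀ {x y} (w : Walk G k x y) i → Walk G (toℕ i) x (vertex w i)
    take _       zero    = []
    take (a ∷ w) (suc i) = a ∷ take w i

    drop : ∀ {x y} (w : Walk G k x y) i → Walk G (k ∸ toℕ i) (vertex w i) y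
    drop w       zero    = w
    drop (_ ∷ w) (suc i) = drop w i

    _++_ : ∀ {x y z} → Walk G k x y → Walk G l y z → Walk G (k + l) x z
    []      ++ w′ = w′
    (a ∷ w) ++ w′ = a ∷ (w ++ w′)

    shorten : ∀ {x y} → n ≤ k → Walk G k x y → ∃[ j ] j < k × Walk G j x y
    shorten {k = k} {y = y} n≤k w with pigeonhole (s≤s n≤k) (vertex w)
    ... | i , j , i<j , eq =
      toℕ i + (k ∸ toℕ j) ,
      subst (toℕ i + (k ∸ toℕ j) <_) (ℕ.m+[n∸m]≡n (toℕ≤pred[n] j))
        (ℕ.+-monoˡ-< (k ∸ toℕ j) i<j) ,
      (take w i ++ subst (λ z → Walk G _ z y) (sym eq) (drop w j))

    short-walk : ∀ x y k → Walk G k x y → ∃[ j ] j < n × Walk G j x y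
    short-walk x y = <-rec _ step
      where
      step : ∀ k → (∀ {j} → j < k → Walk G j x y → ∃[ i ] i < n × Walk G i x y) →
             Walk G k x y → ∃[ i ] i < n × Walk G i x y
      step k rec w with k ℕ.<? n
      ... | yes k<n = k , k<n , w
      ... | no  k≮n = let (_ , j<k , w′) = shorten (ℕ.≮⇒≥ k≮n) w in rec j<k w′

  distance-exists : ∀ x y → ∃ (IsMin λ k → Walk G k x y)
  distance-exists x y = minimum (walk? x y) n (short-walk x y)

  distance : Fin n → Fin n → ℕ∞
  distance x y = proj₁ (distance-exists x y)

------------------------------------------------------------------------
-- Smallest size of a set of vertices with a given property

HasSize : (Subset n → Set) → ℕ → Set
HasSize P k = ∃[ M ] P M × ∣ M ∣ ≡ k

minSize-exists : {P : Subset n → Set} → Decidable P → ∃ (IsMin (HasSize P))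
minSize-exists {n = n} P? = minimum
  (λ k → anySubset? λ M → P? M ×-dec ∣ M ∣ ℕ.≟ k)
  (suc n)
  (λ { _ (M , pM , refl) → ∣ M ∣ , s≤s (∣p∣≤n M) , M , pM , refl })

minSize : {P : Subset n → Set} → Decidable P → ℕ∞
minSize P? = proj₁ (minSize-exists P?)

------------------------------------------------------------------------
-- Vertex covers and distance-edge-monitoring sets

module _ (G : Graph n) where

  VertexCover : Subset n → Set
  VertexCover C = ∀ u v → Adj G u v → u ∈ C ⊎ v ∈ C

  vertexCover? : Decidable VertexCover
  vertexCover? C = all? λ u → all? λ v →
    adj? G u v →-dec (u ∈? C ⊎-dec v ∈? C)

  vc : ℕ∞
  vc = minSize vertexCover?

  -- x monitors the edge with ends u and v.
  Monitors : Fin n → Fin n → Fin n → Set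
  Monitors x u v = ∃[ y ] distance G x y ≢ distance (deleteEdge G u v) x y

  monitors? : ∀ x u v → Dec (Monitors x u v)
  monitors? x u v = any? λ y →
    ¬? (Maybe.≡-dec ℕ._≟_ (distance G x y) (distance (deleteEdge G u v) x y))

  DistanceEdgeMonitoring : Subset n → Set
  DistanceEdgeMonitoring M =
    ∀ u v → Adj G u v → ∃[ x ] x ∈ M × Monitors x u v

  distanceEdgeMonitoring? : Decidable DistanceEdgeMonitoring
  distanceEdgeMonitoring? M = all? λ u → all? λ v →
    adj? G u v →-dec (any? λ x → x ∈? M ×-dec monitors? x u v)

  dem : ℕ∞
  dem = minSize distanceEdgeMonitoring?

{-# OPTIONS --safe #-}
module Submission where

-- The endpoints of an edge monitor it through each other, so vertex covers are
-- distance-edge-monitoring. The complement of a single vertex is a vertex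
-- cover, and so is the complement of two distinct non-adjacent vertices; the
-- latter gives dem(G) < n − 1 as soon as G is not complete. In a complete graph
-- deleting an edge xy changes no distance from a vertex other than x and y, so
-- a monitoring set misses at most one vertex.

open import Defs
open import Data.Fin.Base using (Fin; zero)
open import Data.Fin.Properties using (_≟_; any?)
open import Data.Fin.Subset using (Subset; _∈_; _⊆_; _-_; ∁; ⁅_⁆; ∣_∣)
open import Data.Fin.Subset.Properties
  using (_∈?_; ∣∁p∣≡n∸∣p∣; ∣⁅x⁆∣≡1; x∉p⇒x∈∁p; x∈∁p⇒x∉p; x≢y⇒x∉⁅y⁆; x∉⁅y⁆⇒x≢y;
         x∈p∧x≢y⇒x∈p-y; x∈p⇒∣p-x∣<∣p∣; p⊆q⇒∣p∣≤∣q∣)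
open import Data.Nat.Base using (ℕ; zero; suc; NonZero; _∸_; _≤_; _<_; z≤n; s≤s)
import Data.Nat.Properties as ℕ
open import Data.Product.Base using (_×_; _,_; proj₂)
open import Data.Sum.Base using (_⊎_; inj₁; inj₂)
open import Function.Base using (_∘_; id)
open import Function.Bundles using (_⇔_; mk⇔)
open import Relation.Binary.Construct.Add.Supremum.NonStrict _≤_
  using ([_]; _≤⊤⁺; [≤]-injective; ≤⁺-antisym-≡; ≤⁺-trans)
open import Relation.Binary.PropositionalEquality
  using (_≡_; _≢_; refl; sym; trans; subst; cong)
open import Relation.Nullary.Decidable using (yes; no; ¬?; decidable-stable)
open import Relation.Nullary.Negation.Core using (¬_; contradiction)

private
  variable
    n k : ℕ
    a b : ℕ∞
    P Q : ℕ → Set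

min-≤ : IsMin P a → P k → a ≤⁺ [ k ]
min-≤ {a = [ _ ]} (_ , least) pk = [ least _ pk ]
min-≤ {a = ⊤⁺}    none        pk = contradiction pk (none _)

≤-min : (∀ j → P j → k ≤ j) → IsMin P a → [ k ] ≤⁺ a
≤-min {a = [ _ ]} lower (pa , _) = [ lower _ pa ]
≤-min {a = ⊤⁺}    _     _        = [ _ ] ≤⊤⁺

min-antitone : (∀ {j} → P j → Q j) → IsMin P a → IsMin Q b → b ≤⁺ a
min-antitone {a = [ _ ]} P⇒Q (pa , _) minQ = min-≤ minQ (P⇒Q pa)
min-antitone {a = ⊤⁺}    _   _        _    = _ ≤⊤⁺

-- This evaluates `distance` by exhibiting a minimum, without unfolding the bounded search that
-- defines it.
min-unique : IsMin P a → IsMin P b → a ≡ b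
min-unique minA minB = ≤⁺-antisym-≡ ℕ.≤-antisym
  (min-antitone id minB minA) (min-antitone id minA minB)

distance-isMin : (G : Graph n) → ∀ x y → IsMin (λ k → Walk G k x y) (distance G x y)
distance-isMin G x y = proj₂ (distance-exists G x y)

distance-refl : (G : Graph n) → ∀ x → distance G x x ≡ [ 0 ]
distance-refl G x = min-unique (distance-isMin G x x) ([] , λ _ _ → z≤n)

adj⇒distance≡1 : (G : Graph n) → ∀ {x y} → Adj G x y → distance G x y ≡ [ 1 ]
adj⇒distance≡1 G {x} {y} xy = min-unique (distance-isMin G x y) (xy ∷ [] , least)
  where
  least : ∀ j → Walk G j x y → 1 ≤ j
  least _ []      = contradiction xy (adj-irrefl G refl)
  least _ (_ ∷ _) = s≤s z≤n

distance≡1⇒adj : (G : Graph n) → ∀ {x y} → distance G x y ≡ [ 1 ] → Adj G x y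
distance≡1⇒adj G {x} {y} d≡1
  -- The minimum is attained, so there is a walk of length 1, and it can only be a single edge.
  with xy ∷ [] , _ ← subst (IsMin (λ k → Walk G k x y)) d≡1 (distance-isMin G x y) = xy

-- The witness is the other end `y`: were its distance from `x` still 1 after the deletion, the
-- deleted edge would still be present. `SameEdge` covers both orientations.
endpoint-monitors : (G : Graph n) → ∀ {x y u v} →
                    Adj G x y → SameEdge x y u v → Monitors G x u v
endpoint-monitors G {y = y} {u} {v} xy same = y , λ d≡d′ →
  proj₂ (distance≡1⇒adj (deleteEdge G u v) (trans (sym d≡d′) (adj⇒distance≡1 G xy))) same

cover⇒monitoring : (G : Graph n) → ∀ C → VertexCover G C → DistanceEdgeMonitoring G C
cover⇒monitoring G C cover u v uv with cover u v uv
... | inj₁ u∈C = u , u∈C , endpoint-monitors G uv (inj₁ (refl , refl))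
... | inj₂ v∈C = v , v∈C , endpoint-monitors G (adj-sym G uv) (inj₂ (refl , refl))

dem≤vc : (G : Graph n) → dem G ≤⁺ vc G
dem≤vc G = min-antitone
  (λ (C , cover , size) → C , cover⇒monitoring G C cover , size)
  (proj₂ (minSize-exists (vertexCover? G)))
  (proj₂ (minSize-exists (distanceEdgeMonitoring? G)))

vc≤∣cover∣ : (G : Graph n) → ∀ {C} → VertexCover G C → vc G ≤⁺ [ ∣ C ∣ ]
vc≤∣cover∣ G {C} cover = min-≤ (proj₂ (minSize-exists (vertexCover? G))) (C , cover , refl)

∣∁⁅x⁆∣≡n∸1 : (x : Fin n) → ∣ ∁ ⁅ x ⁆ ∣ ≡ n ∸ 1
∣∁⁅x⁆∣≡n∸1 {n} x = trans (∣∁p∣≡n∸∣p∣ ⁅ x ⁆) (cong (n ∸_) (∣⁅x⁆∣≡1 x))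

x≢y⇒y∈∁⁅x⁆ : {x y : Fin n} → x ≢ y → y ∈ ∁ ⁅ x ⁆
x≢y⇒y∈∁⁅x⁆ x≢y = x∉p⇒x∈∁p (x≢y⇒x∉⁅y⁆ (x≢y ∘ sym))

cover-omitting-vertex : (G : Graph n) → ∀ x → VertexCover G (∁ ⁅ x ⁆)
cover-omitting-vertex G x u v uv with x ≟ u
... | no x≢u   = inj₁ (x≢y⇒y∈∁⁅x⁆ x≢u)
... | yes refl = inj₂ (x≢y⇒y∈∁⁅x⁆ λ x≡v → adj-irrefl G x≡v uv)

-- An uncovered edge would have both ends among `x` and `y`, hence be a loop or the excluded edge.
cover-omitting-nonedge : (G : Graph n) → ∀ {x y} → ¬ Adj G x y →
                         VertexCover G (∁ ⁅ x ⁆ - y)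
cover-omitting-nonedge G {x} {y} ¬xy u v uv
  with cover-omitting-vertex G x u v uv | u ≟ y | v ≟ y
... | inj₁ u∈ | no u≢y   | _        = inj₁ (x∈p∧x≢y⇒x∈p-y u∈ u≢y)
... | inj₂ v∈ | _        | no v≢y   = inj₂ (x∈p∧x≢y⇒x∈p-y v∈ v≢y)
... | _       | yes refl | yes refl = contradiction uv (adj-irrefl G refl)
-- Here `u` is the removed vertex `y`, so `v` must cover; `v` equal to `x` would give the forbidden
-- edge.
... | inj₁ _  | yes refl | no v≢y   = inj₂ (x∈p∧x≢y⇒x∈p-y (x≢y⇒y∈∁⁅x⁆ x≢v) v≢y)
  where
  x≢v : x ≢ v
  x≢v refl = ¬xy (adj-sym G uv)
... | inj₂ _  | no u≢y   | yes refl = inj₁ (x∈p∧x≢y⇒x∈p-y (x≢y⇒y∈∁⁅x⁆ x≢u) u≢y)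
  where
  x≢u : x ≢ u
  x≢u refl = ¬xy uv

vc≤n∸1 : (G : Graph n) → Fin n → vc G ≤⁺ [ n ∸ 1 ]
vc≤n∸1 G x = subst (λ k → vc G ≤⁺ [ k ]) (∣∁⁅x⁆∣≡n∸1 x)
  (vc≤∣cover∣ G (cover-omitting-vertex G x))

dem≡n∸1⇒complete : (G : Graph n) → dem G ≡ [ n ∸ 1 ] → Complete G
dem≡n∸1⇒complete {n} G dem≡ x y x≢y = decidable-stable (adj? G x y) λ ¬xy →
  ℕ.<⇒≱ smaller ([≤]-injective
    (subst (_≤⁺ [ ∣ ∁ ⁅ x ⁆ - y ∣ ]) dem≡
      (≤⁺-trans ℕ.≤-trans (dem≤vc G) (vc≤∣cover∣ G (cover-omitting-nonedge G ¬xy)))))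
  where
  smaller : ∣ ∁ ⁅ x ⁆ - y ∣ < n ∸ 1
  smaller = subst (∣ ∁ ⁅ x ⁆ - y ∣ <_) (∣∁⁅x⁆∣≡n∸1 x)
    -- Strictness comes from `x≢y`: `y` still lies in the complement of `x`, so removing it lowers
    -- the size.
    (x∈p⇒∣p-x∣<∣p∣ (x≢y⇒y∈∁⁅x⁆ x≢y))

-- From any other vertex `x`, the distance to `y` is 0 or 1 both before and after the deletion,
-- since the edge from `x` to `y` survives.
complete⇒monitor-is-endpoint : (G : Graph n) → Complete G → ∀ {x u v} →
                               Monitors G x u v → x ≡ u ⊎ x ≡ v
complete⇒monitor-is-endpoint G complete {x} {u} {v} (y , d≢d′)
  with x ≟ u | x ≟ v | x ≟ y
... | yes x≡u | _       | _        = inj₁ x≡u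
... | _       | yes x≡v | _        = inj₂ x≡v
... | _       | _       | yes refl =
  contradiction (trans (distance-refl G x) (sym (distance-refl (deleteEdge G u v) x))) d≢d′
... | no x≢u  | no x≢v  | no x≢y   =
  contradiction
    (trans (adj⇒distance≡1 G xy) (sym (adj⇒distance≡1 (deleteEdge G u v) (xy , other))))
    d≢d′
  where
  xy : Adj G x y
  xy = complete x y x≢y

  other : ¬ SameEdge x y u v
  other (inj₁ (x≡u , _)) = x≢u x≡u
  other (inj₂ (x≡v , _)) = x≢v x≡v

complete⇒monitoring-meets-pairs : (G : Graph n) → Complete G → ∀ {M} →
  DistanceEdgeMonitoring G M → ∀ {x y} → x ≢ y → x ∈ M ⊎ y ∈ M
complete⇒monitoring-meets-pairs G complete monitoring {x} {y} x≢y
  with z , z∈M , monitors ← monitoring x y (complete x y x≢y)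
  with complete⇒monitor-is-endpoint G complete monitors
... | inj₁ refl = inj₁ z∈M
... | inj₂ refl = inj₂ z∈M

-- Two vertices outside `M` would form an unmet pair, so `M` contains the complement of some
-- singleton.
meets-pairs⇒n∸1≤∣M∣ : (M : Subset n) → (∀ {x y} → x ≢ y → x ∈ M ⊎ y ∈ M) → n ∸ 1 ≤ ∣ M ∣
meets-pairs⇒n∸1≤∣M∣ {zero}  M _     = z≤n
meets-pairs⇒n∸1≤∣M∣ {suc n} M meets with any? (λ x → ¬? (x ∈? M))
... | yes (x , x∉M) = subst (_≤ ∣ M ∣) (∣∁⁅x⁆∣≡n∸1 x) (p⊆q⇒∣p∣≤∣q∣ ∁⁅x⁆⊆M)
  where
  ∁⁅x⁆⊆M : ∁ ⁅ x ⁆ ⊆ M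
  ∁⁅x⁆⊆M y∈ with meets (x∉⁅y⁆⇒x≢y (x∈∁p⇒x∉p y∈))
  ... | inj₁ y∈M = y∈M
  ... | inj₂ x∈M = contradiction x∈M x∉M
-- `M` contains every vertex, so any singleton serves; `zero` exists because the order is a
-- successor.
... | no full = subst (_≤ ∣ M ∣) (∣∁⁅x⁆∣≡n∸1 zero)
  (p⊆q⇒∣p∣≤∣q∣ {p = ∁ ⁅ zero ⁆} λ {y} _ → decidable-stable (y ∈? M) λ y∉M → full (y , y∉M))

complete⇒n∸1≤dem : (G : Graph n) → Complete G → [ n ∸ 1 ] ≤⁺ dem G
complete⇒n∸1≤dem {n} G complete =
  ≤-min lower (proj₂ (minSize-exists (distanceEdgeMonitoring? G)))
  where
  lower : ∀ j → HasSize (DistanceEdgeMonitoring G) j → n ∸ 1 ≤ j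
  lower _ (M , monitoring , refl) =
    meets-pairs⇒n∸1≤∣M∣ M (complete⇒monitoring-meets-pairs G complete monitoring)

theorem12 : (n : ℕ) → .{{_ : NonZero n}} → (G : Graph n) → Connected G →
    ((C : Subset n) → VertexCover G C → DistanceEdgeMonitoring G C)
    × (dem G ≤⁺ vc G)
    × (vc G ≤⁺ [ n ∸ 1 ])
    × (dem G ≡ [ n ∸ 1 ] ⇔ Complete G)
theorem12 (suc n) G _ =
  cover⇒monitoring G ,
  dem≤vc G ,
  -- A nonempty graph has the vertex `zero` to omit from the cover.
  vc≤n∸1 G zero ,
  mk⇔ (dem≡n∸1⇒complete G) λ complete →
    ≤⁺-antisym-≡ ℕ.≤-antisym
      (≤⁺-trans ℕ.≤-trans (dem≤vc G) (vc≤n∸1 G zero))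
      (complete⇒n∸1≤dem G complete)
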